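{- Let $G$ be a finite abstract simplicial complex and let $V=\{x\in G : |x|=1\}$. Then, as polynomials in $t$, $$ f_G(t)-1 = \sum_{v \in V} F_{S(v)}(t). $$
   Context: A finite abstract simplicial complex is a finite set of non-empty finite sets closed under taking non-empty subsets. For a complex $H$ of maximal dimension $d$ (maximal $|x|-1$), $f_k(H)$ is the number of elements of $H$ of cardinality $k+1$, and $f_H(t)=1+\sum_{k=0}^{d} f_k(H)\,t^{k+1}$ (so $f_H(t)=1$ for the empty complex); $F_H(t)=\int_0^t f_H(s)\,ds$. For $x\in G$: $U(x)=\{y\in G: x\subset y\}$, $B(x)=\{y\in G : y\subset z \text{ for some } z\in U(x)\}$, and the unit sphere $S(x)=B(x)\setminus U(x)$, which is again a simplicial complex. -}

module Defs where

open import Data.Bool.Properties using () renaming (_≟_ to _≟ᵇ_)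
open import Data.Fin.Subset using (Subset; Nonempty; _⊆_; ∣_∣)
open import Data.Fin.Subset.Properties using (_⊆?_; ⊆-trans)
open import Data.Integer using (+_)
open import Data.List using (List; []; _∷_; [_]; map; foldr; filter; length; applyUpTo)
open import Data.List.Extrema.Nat using (max)
open import Data.List.Membership.Propositional using (_∈_; find; lose)
open import Data.List.Membership.Propositional.Properties using (∈-filter⁺; ∈-filter⁻)
open import Data.List.Relation.Unary.Any using (any?)
open import Data.List.Relation.Unary.Unique.Propositional using (Unique)
open import Data.List.Relation.Unary.Unique.Propositional.Properties using (filter⁺)
open import Data.Nat using (ℕ; zero; suc)
open import Data.Nat.Properties using () renaming (_≟_ to _≟ℕ_)
open import Data.Product using (_,_; proj₁; proj₂)
open import Data.Rational using (ℚ; 0ℚ; 1ℚ; _/_; _+_; _*_; -_)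
open import Data.Vec.Properties using (≡-dec)
open import Relation.Binary.Definitions using (DecidableEquality)
open import Relation.Binary.PropositionalEquality using (_≡_)
open import Relation.Nullary.Decidable using (¬?)

-- Polynomials over ℚ in one variable t: a₀ ∷ a₁ ∷ … ∷ aₘ ∷ [] is a₀ + a₁ t + … + aₘ tᵐ.
-- Trailing zeros are allowed, so equality of polynomials is _≈ₚ_, not _≡_.

Poly : Set
Poly = List ℚ

coeff : Poly → ℕ → ℚ
coeff []       _       = 0ℚ
coeff (a ∷ _)  zero    = a
coeff (_ ∷ as) (suc i) = coeff as i

infix  4 _≈ₚ_
infixl 6 _+ₚ_ _-ₚ_

_≈ₚ_ : Poly → Poly → Set
p ≈ₚ q = ∀ i → coeff p i ≡ coeff q i

0ₚ 1ₚ : Poly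
0ₚ = []
1ₚ = [ 1ℚ ]

_+ₚ_ : Poly → Poly → Poly
[]       +ₚ q        = q
(a ∷ as) +ₚ []       = a ∷ as
(a ∷ as) +ₚ (b ∷ bs) = (a + b) ∷ (as +ₚ bs)

_-ₚ_ : Poly → Poly → Poly
p -ₚ q = p +ₚ map -_ q

sumₚ : List Poly → Poly
sumₚ = foldr _+ₚ_ 0ₚ

-- Divides the i-th entry by k + 1 + i.
divideFrom : ℕ → Poly → Poly
divideFrom k []       = []
divideFrom k (a ∷ as) = (a * (+ 1 / suc k)) ∷ divideFrom (suc k) as

-- ∫₀ᵗ p(s) ds, that is Σᵢ aᵢ tⁱ⁺¹ / (i + 1).
∫₀ : Poly → Poly
∫₀ p = 0ℚ ∷ divideFrom 0 p

-- The finite sets are taken inside a finite ground set Fin n. Points of Fin n that lie in no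
-- face are allowed, so every finite complex arises this way up to naming of its points.
-- The finite set of faces is given as a list without repetitions.

record SimplicialComplex (n : ℕ) : Set where
  field
    faces    : List (Subset n)
    unique   : Unique faces
    nonempty : ∀ {x} → x ∈ faces → Nonempty x
    closed   : ∀ {x y} → x ∈ faces → Nonempty y → y ⊆ x → y ∈ faces

open SimplicialComplex public

module _ {n : ℕ} where

  _≟ˢ_ : DecidableEquality (Subset n)
  _≟ˢ_ = ≡-dec _≟ᵇ_

  open import Data.List.Membership.DecPropositional _≟ˢ_ using (_∈?_)

  -- d + 1, where d is the maximal dimension; it is 0 for the empty complex.
  maxCard : SimplicialComplex n → ℕ
  maxCard H = max 0 (map ∣_∣ (faces H))

  fCount : SimplicialComplex n → ℕ → ℕ
  fCount H k = length (filter (λ x → ∣ x ∣ ≟ℕ suc k) (faces H))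

  -- 1 + Σ_{k=0}^{d} f_k(H) tᵏ⁺¹
  fPoly : SimplicialComplex n → Poly
  fPoly H = 1ℚ ∷ applyUpTo (λ k → + fCount H k / 1) (maxCard H)

  FPoly : SimplicialComplex n → Poly
  FPoly H = ∫₀ (fPoly H)

  vertices : SimplicialComplex n → List (Subset n)
  vertices G = filter (λ x → ∣ x ∣ ≟ℕ 1) (faces G)

  U : SimplicialComplex n → Subset n → List (Subset n)
  U G x = filter (x ⊆?_) (faces G)

  B : SimplicialComplex n → Subset n → List (Subset n)
  B G x = filter (λ y → any? (y ⊆?_) (U G x)) (faces G)

  S : SimplicialComplex n → Subset n → SimplicialComplex n
  S G x = record
    { faces    = filter ∉U? (B G x)
    ; unique   = filter⁺ ∉U? (filter⁺ inB? (unique G))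
    ; nonempty = λ y∈S → nonempty G (proj₁ (∈-filter⁻ inB? (proj₁ (∈-filter⁻ ∉U? {xs = B G x} y∈S))))
    ; closed   = λ {y} {y′} y∈S y′≠∅ y′⊆y →
        let y∈B , y∉U     = ∈-filter⁻ ∉U? {xs = B G x} y∈S
            y∈G , y⊆some  = ∈-filter⁻ inB? {xs = faces G} y∈B
            z , z∈U , y⊆z = find y⊆some
            y′∈B = ∈-filter⁺ inB? (closed G y∈G y′≠∅ y′⊆y)
                     (lose z∈U (⊆-trans {i = y′} {j = y} {k = z} y′⊆y y⊆z))
        in ∈-filter⁺ ∉U? y′∈B λ y′∈U → y∉U
             (∈-filter⁺ (x ⊆?_) y∈G
               (⊆-trans {i = x} {j = y′} {k = y} (proj₂ (∈-filter⁻ (x ⊆?_) {xs = faces G} y′∈U)) y′⊆y))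
    }
    where
    ∉U?  = λ y → ¬? (y ∈? U G x)
    inB? = λ y → any? (y ⊆?_) (U G x)

{-# OPTIONS --safe #-}

-- Comparing coefficients of tᵏ⁺¹, the claim is (k + 1) f_k(G) = Σ_v f_{k-1}(S(v)), with f_{-1} = 1.
-- For a vertex v = {i}, toggling the membership of i is a bijection between the faces of S(v) with
-- k elements and the faces of G with k + 1 elements that contain v. Hence the right-hand side counts
-- the pairs v ⊆ x with x a face of k + 1 elements, and each such x contains exactly k + 1 vertices.
module Submission where

open import Defs
open import Data.Bool using (not)
open import Data.Bool.Properties using (not-involutive)
open import Data.Fin using (Fin; zero; suc)
open import Data.Fin.Properties using (suc-injective)
open import Data.Fin.Subset using (Subset; inside; outside; Nonempty; _⊆_; ∣_∣; ⁅_⁆; ⊥) renaming (_∈_ to _∈ˢ_; _∉_ to _∉ˢ_)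
open import Data.Fin.Subset.Properties using (_⊆?_; x∈⁅x⁆; x∈⁅y⁆⇒x≡y; ∣⁅x⁆∣≡1; drop-there)
import Data.Integer as ℤ
import Data.Integer.Properties as ℤ
open import Data.List using (List; []; _∷_; map; filter; length; applyUpTo)
open import Data.List.Extrema.Nat using (xs≤max)
open import Data.List.Membership.Propositional using (_∈_; find; lose)
open import Data.List.Membership.Propositional.Properties using (∈-filter⁺; ∈-filter⁻; ∈-map⁺; ∈-map⁻)
open import Data.List.Properties using (length-map; filter-none)
open import Data.List.Relation.Binary.BagAndSetEquality using (∼bag⇒↭)
open import Data.List.Membership.Propositional.Properties.WithK using (unique∧set⇒bag)
open import Data.List.Relation.Binary.Permutation.Propositional.Properties using (↭-length)
open import Data.List.Relation.Unary.All as All using ([]; _∷_)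
open import Data.List.Relation.Unary.All.Properties as All using ()
open import Data.List.Relation.Unary.AllPairs using ([]; _∷_)
open import Data.List.Relation.Unary.Any using (any?; here; there)
open import Data.List.Relation.Unary.Unique.Propositional using (Unique)
open import Data.List.Relation.Unary.Unique.Propositional.Properties using (map⁺; filter⁺)
open import Data.Nat as ℕ using (ℕ; zero; suc; z≤n; s≤s; _≤_)
open import Data.Nat.ListAction using (sum)
open import Data.Nat.Properties as ℕ using ()
open import Data.Nat.Solver using (module +-*-Solver)
open import Data.Product using (∃; _×_; _,_; proj₂)
open import Data.Rational using (ℚ; 0ℚ; _+_; _*_; -_; _/_; toℚᵘ)
open import Data.Rational.Properties using (+-identityˡ; +-identityʳ; *-zeroˡ; *-distribʳ-+; toℚᵘ-injective; toℚᵘ-fromℚᵘ; toℚᵘ-homo-+; toℚᵘ-homo-*)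
open import Data.Rational.Unnormalised as ℚᵘ using (mkℚᵘ; *≡*)
import Data.Rational.Unnormalised.Properties as ℚᵘ
open import Data.Vec using ([]; _∷_; here; there; _[_]%=_)
open import Data.Vec.Properties using (updateAt-updateAt-local; updateAt-id; updateAt-updates; []=-injective)
open import Function using (_∘_; _⇔_; mk⇔)
open import Relation.Binary.PropositionalEquality using (_≡_; refl; sym; trans; cong; cong₂; subst; module ≡-Reasoning)
import Relation.Binary.Reasoning.Setoid as SetoidReasoning
open import Relation.Nullary using (Dec; ¬_; yes; no; contradiction)
open import Relation.Nullary.Decidable using (¬?)
open import Relation.Unary using (Decidable)

open ≡-Reasoning
module ≃-Reasoning = SetoidReasoning ℚᵘ.≃-setoid

private
  variable
    n : ℕ
    A C : Set

-- Counting in lists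

-- Lists without repetitions that have the same members agree as bags, hence are permutations of
-- each other. Bijections between families of faces become equalities of counts this way, by
-- comparing members only.
length-unique : {xs ys : List A} → Unique xs → Unique ys → (∀ {z} → z ∈ xs ⇔ z ∈ ys) → length xs ≡ length ys
length-unique u v eq = ↭-length (∼bag⇒↭ (unique∧set⇒bag u v eq))

sum-map-zero : (ys : List A) → sum (map (λ _ → 0) ys) ≡ 0
sum-map-zero []       = refl
sum-map-zero (_ ∷ ys) = sum-map-zero ys

sum-map-+ : (f g : A → ℕ) (xs : List A) → sum (map (λ x → f x ℕ.+ g x) xs) ≡ sum (map f xs) ℕ.+ sum (map g xs)
sum-map-+ f g []       = refl
sum-map-+ f g (x ∷ xs) = begin
  f x ℕ.+ g x ℕ.+ sum (map (λ y → f y ℕ.+ g y) xs)      ≡⟨ cong (f x ℕ.+ g x ℕ.+_) (sum-map-+ f g xs) ⟩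
  f x ℕ.+ g x ℕ.+ (sum (map f xs) ℕ.+ sum (map g xs))   ≡⟨ solve 4 (λ a b c d → a :+ b :+ (c :+ d) := a :+ c :+ (b :+ d)) refl (f x) (g x) (sum (map f xs)) (sum (map g xs)) ⟩
  f x ℕ.+ sum (map f xs) ℕ.+ (g x ℕ.+ sum (map g xs))   ∎
  where open +-*-Solver

sum-map-cong : {f g : A → ℕ} (xs : List A) → (∀ {x} → x ∈ xs → f x ≡ g x) → sum (map f xs) ≡ sum (map g xs)
sum-map-cong []       eq = refl
sum-map-cong (x ∷ xs) eq = cong₂ ℕ._+_ (eq (here refl)) (sum-map-cong xs (eq ∘ there))

sum-map-const : {f : A → ℕ} {c : ℕ} (xs : List A) → (∀ {x} → x ∈ xs → f x ≡ c) → sum (map f xs) ≡ length xs ℕ.* c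
sum-map-const []       eq = refl
sum-map-const (x ∷ xs) eq = cong₂ ℕ._+_ (eq (here refl)) (sum-map-const xs (eq ∘ there))

-- The length of a filtered one-element list serves as the 0/1 indicator of `P x`.
length-filter-∷ : {P : A → Set} (P? : Decidable P) (x : A) (xs : List A) →
  length (filter P? (x ∷ xs)) ≡ length (filter P? (x ∷ [])) ℕ.+ length (filter P? xs)
length-filter-∷ P? x xs with P? x
... | yes _ = refl
... | no  _ = refl

length-filter≡sum : {P : A → Set} (P? : Decidable P) (xs : List A) →
  length (filter P? xs) ≡ sum (map (λ x → length (filter P? (x ∷ []))) xs)
length-filter≡sum P? []       = refl
length-filter≡sum P? (x ∷ xs) = trans (length-filter-∷ P? x xs) (cong (_ ℕ.+_) (length-filter≡sum P? xs))

-- Induction on `xs`: the row of `x` is broken into indicators, one for each `y`, and these are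
-- added to the column counts of the remaining list. `flip` holds because both of its sides are the
-- indicator of `R x y`.
double-counting : {R : A → C → Set} (R? : ∀ x y → Dec (R x y)) (xs : List A) (ys : List C) →
  sum (map (λ x → length (filter (R? x) ys)) xs) ≡ sum (map (λ y → length (filter (λ x → R? x y) xs)) ys)
double-counting R? []       ys = sym (sum-map-zero ys)
double-counting R? (x ∷ xs) ys = begin
  length (filter (R? x) ys) ℕ.+ sum (map (λ x → length (filter (R? x) ys)) xs)
    ≡⟨ cong₂ ℕ._+_ (trans (length-filter≡sum (R? x) ys) (sum-map-cong ys λ {y} _ → flip y)) (double-counting R? xs ys) ⟩
  sum (map (λ y → length (filter (λ x → R? x y) (x ∷ []))) ys) ℕ.+ sum (map (λ y → length (filter (λ x → R? x y) xs)) ys)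
    ≡⟨ sum-map-+ _ _ ys ⟨
  sum (map (λ y → length (filter (λ x → R? x y) (x ∷ [])) ℕ.+ length (filter (λ x → R? x y) xs)) ys)
    ≡⟨ sum-map-cong ys (λ {y} _ → sym (length-filter-∷ (λ x → R? x y) x xs)) ⟩
  sum (map (λ y → length (filter (λ x → R? x y) (x ∷ xs))) ys) ∎
  where
  flip : ∀ y → length (filter (R? x) (y ∷ [])) ≡ length (filter (λ x → R? x y) (x ∷ []))
  flip y with R? x y
  ... | yes _ = refl
  ... | no  _ = refl

-- Subsets of Fin n

elements : Subset n → List (Fin n)
elements []            = []
elements (inside  ∷ p) = zero ∷ map suc (elements p)
elements (outside ∷ p) = map suc (elements p)

length-elements : (p : Subset n) → length (elements p) ≡ ∣ p ∣
length-elements []            = refl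
length-elements (inside  ∷ p) = cong suc (trans (length-map suc (elements p)) (length-elements p))
length-elements (outside ∷ p) = trans (length-map suc (elements p)) (length-elements p)

elements-unique : (p : Subset n) → Unique (elements p)
elements-unique []            = []
elements-unique (inside  ∷ p) = All.map⁺ (All.tabulate λ _ ()) ∷ map⁺ suc-injective (elements-unique p)
elements-unique (outside ∷ p) = map⁺ suc-injective (elements-unique p)

∈-elements⁺ : {p : Subset n} {i : Fin n} → i ∈ˢ p → i ∈ elements p
∈-elements⁺                   here        = here refl
∈-elements⁺ {p = inside  ∷ _} (there i∈p) = there (∈-map⁺ suc (∈-elements⁺ i∈p))
∈-elements⁺ {p = outside ∷ _} (there i∈p) = ∈-map⁺ suc (∈-elements⁺ i∈p)

∈-elements⁻ : (p : Subset n) {i : Fin n} → i ∈ elements p → i ∈ˢ p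
∈-elements⁻ (inside  ∷ p) (here refl) = here
∈-elements⁻ (inside  ∷ p) (there i∈) with _ , j∈ , refl ← ∈-map⁻ suc i∈ = there (∈-elements⁻ p j∈)
∈-elements⁻ (outside ∷ p) i∈         with _ , j∈ , refl ← ∈-map⁻ suc i∈ = there (∈-elements⁻ p j∈)

∣p∣≡1+k⇒Nonempty : (p : Subset n) {k : ℕ} → ∣ p ∣ ≡ suc k → Nonempty p
∣p∣≡1+k⇒Nonempty (inside  ∷ p) eq = zero , here
∣p∣≡1+k⇒Nonempty (outside ∷ p) eq with i , i∈p ← ∣p∣≡1+k⇒Nonempty p eq = suc i , there i∈p

∣p∣≡0⇒p≡⊥ : (p : Subset n) → ∣ p ∣ ≡ 0 → p ≡ ⊥
∣p∣≡0⇒p≡⊥ []            eq = refl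
∣p∣≡0⇒p≡⊥ (outside ∷ p) eq = cong (outside ∷_) (∣p∣≡0⇒p≡⊥ p eq)

∣p∣≡1⇒singleton : (p : Subset n) → ∣ p ∣ ≡ 1 → ∃ λ i → p ≡ ⁅ i ⁆
∣p∣≡1⇒singleton (inside  ∷ p) eq = zero , cong (inside ∷_) (∣p∣≡0⇒p≡⊥ p (ℕ.suc-injective eq))
∣p∣≡1⇒singleton (outside ∷ p) eq with i , refl ← ∣p∣≡1⇒singleton p eq = suc i , refl

⁅⁆-injective : {i j : Fin n} → ⁅ i ⁆ ≡ ⁅ j ⁆ → i ≡ j
⁅⁆-injective {i = i} {j} eq = x∈⁅y⁆⇒x≡y j (subst (i ∈ˢ_) eq (x∈⁅x⁆ i))

⁅i⁆⊆p : {i : Fin n} {p : Subset n} → i ∈ˢ p → ⁅ i ⁆ ⊆ p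
⁅i⁆⊆p {i = i} i∈p j∈⁅i⁆ with refl ← x∈⁅y⁆⇒x≡y i j∈⁅i⁆ = i∈p

-- A single involution stands for both insertion and deletion of `i`, so injectivity and
-- surjectivity of the correspondence come from `toggle-involutive` alone.
toggle : Fin n → Subset n → Subset n
toggle i p = p [ i ]%= not

toggle-involutive : (i : Fin n) (p : Subset n) → toggle i (toggle i p) ≡ p
toggle-involutive i p = trans (updateAt-updateAt-local i p (not-involutive _)) (updateAt-id i p)

toggle-injective : (i : Fin n) {p q : Subset n} → toggle i p ≡ toggle i q → p ≡ q
toggle-injective i {p} {q} eq = trans (sym (toggle-involutive i p)) (trans (cong (toggle i) eq) (toggle-involutive i q))

∣toggle∣ : (i : Fin n) (p : Subset n) → i ∉ˢ p → ∣ toggle i p ∣ ≡ suc ∣ p ∣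
∣toggle∣ zero    (inside  ∷ p) i∉p = contradiction here i∉p
∣toggle∣ zero    (outside ∷ p) i∉p = refl
∣toggle∣ (suc i) (inside  ∷ p) i∉p = cong suc (∣toggle∣ i p (i∉p ∘ there))
∣toggle∣ (suc i) (outside ∷ p) i∉p = ∣toggle∣ i p (i∉p ∘ there)

i∈toggle : (i : Fin n) (p : Subset n) → i ∉ˢ p → i ∈ˢ toggle i p
i∈toggle zero    (inside  ∷ p) i∉p = contradiction here i∉p
i∈toggle zero    (outside ∷ p) i∉p = here
i∈toggle (suc i) (_       ∷ p) i∉p = there (i∈toggle i p (i∉p ∘ there))

i∉toggle : (i : Fin n) (p : Subset n) → i ∈ˢ p → i ∉ˢ toggle i p
-- After toggling, the entry at `i` is `not inside`, which clashes with `inside`.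
i∉toggle i p i∈p i∈t with () ← []=-injective (updateAt-updates i p i∈p) i∈t

-- Only the membership of `i` changes, and `i` lies in `q` anyway. This keeps the toggled set below
-- a known face, so that `closed` applies.
toggle-⊆ : (i : Fin n) (p : Subset n) {q : Subset n} → p ⊆ q → i ∈ˢ q → toggle i p ⊆ q
toggle-⊆ zero    (_ ∷ p) p⊆q i∈q {zero}  _          = i∈q
toggle-⊆ zero    (_ ∷ p) p⊆q i∈q {suc j} (there j∈) = p⊆q (there j∈)
toggle-⊆ (suc i) (_ ∷ p) p⊆q i∈q {zero}  here       = p⊆q here
toggle-⊆ (suc i) (_ ∷ p) {_ ∷ q} p⊆q (there i∈q) {suc j} (there j∈) =
  there (toggle-⊆ i p {q} (λ k∈p → drop-there (p⊆q (there k∈p))) i∈q j∈)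

-- Counting faces

module _ {n : ℕ} (G : SimplicialComplex n) where

  open import Data.List.Membership.DecPropositional (_≟ˢ_ {n}) using (_∈?_)

  facesOfCard : ℕ → List (Subset n)
  facesOfCard m = filter (λ x → ∣ x ∣ ℕ.≟ m) (faces G)

  module _ {v : Subset n} where

    private
      ∉U?  = λ y → ¬? (y ∈? U G v)
      inB? = λ y → any? (y ⊆?_) (U G v)

    -- As `y` is already a face, lying outside `U G v` amounts to `¬ (v ⊆ y)`; lying in `B G v`
    -- supplies a face `z` above both `v` and `y`.
    ∈-S⁻ : ∀ {y} → y ∈ faces (S G v) → y ∈ faces G × (∃ λ z → z ∈ faces G × v ⊆ z × y ⊆ z) × ¬ (v ⊆ y)
    ∈-S⁻ y∈S =
      let y∈B , y∉U     = ∈-filter⁻ ∉U? {xs = B G v} y∈S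
          y∈G , y⊆some  = ∈-filter⁻ inB? {xs = faces G} y∈B
          z , z∈U , y⊆z = find y⊆some
          z∈G , v⊆z     = ∈-filter⁻ (v ⊆?_) {xs = faces G} z∈U
      in y∈G , (z , z∈G , v⊆z , y⊆z) , λ v⊆y → y∉U (∈-filter⁺ (v ⊆?_) y∈G v⊆y)

    ∈-S⁺ : ∀ {y z} → y ∈ faces G → z ∈ faces G → v ⊆ z → y ⊆ z → ¬ (v ⊆ y) → y ∈ faces (S G v)
    ∈-S⁺ y∈G z∈G v⊆z y⊆z v⊈y =
      ∈-filter⁺ ∉U? (∈-filter⁺ inB? y∈G (lose (∈-filter⁺ (v ⊆?_) z∈G v⊆z) y⊆z))
        λ y∈U → v⊈y (proj₂ (∈-filter⁻ (v ⊆?_) {xs = faces G} y∈U))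

  -- `toggle i` carries `link` onto `star` and raises the cardinality from `1 + k` to `2 + k`. By
  -- injectivity the mapped list stays free of repetitions, so only its members have to be compared
  -- with those of `star`.
  fCount-S : (k : ℕ) (i : Fin n) → fCount (S G ⁅ i ⁆) k ≡ length (filter (⁅ i ⁆ ⊆?_) (facesOfCard (2 ℕ.+ k)))
  fCount-S k i = begin
    fCount (S G ⁅ i ⁆) k         ≡⟨ length-map (toggle i) link ⟨
    length (map (toggle i) link) ≡⟨ length-unique
      (map⁺ (toggle-injective i) (filter⁺ _ (unique (S G ⁅ i ⁆))))
      (filter⁺ _ (filter⁺ _ (unique G)))
      (mk⇔ to from) ⟩
    length star                  ∎
    where
    link = filter (λ x → ∣ x ∣ ℕ.≟ suc k) (faces (S G ⁅ i ⁆))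
    star = filter (⁅ i ⁆ ⊆?_) (facesOfCard (2 ℕ.+ k))

    to : ∀ {x} → x ∈ map (toggle i) link → x ∈ star
    to x∈ with ∈-map⁻ (toggle i) x∈
    ... | y , y∈link , refl =
      let y∈S , ∣y∣≡                        = ∈-filter⁻ _ {xs = faces (S G ⁅ i ⁆)} y∈link
          y∈G , (z , z∈G , v⊆z , y⊆z) , v⊈y = ∈-S⁻ y∈S
          i∉y  = λ i∈y → v⊈y (⁅i⁆⊆p i∈y)
          i∈ty = i∈toggle i y i∉y
          -- The face `z` contains both `y` and `i`, hence also `y` with `i` added.
          ty∈G = closed G z∈G (i , i∈ty) (toggle-⊆ i y y⊆z (v⊆z (x∈⁅x⁆ i)))
      in ∈-filter⁺ (⁅ i ⁆ ⊆?_) (∈-filter⁺ _ ty∈G (trans (∣toggle∣ i y i∉y) (cong suc ∣y∣≡))) (⁅i⁆⊆p i∈ty)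

    from : ∀ {x} → x ∈ star → x ∈ map (toggle i) link
    from {x} x∈star =
      let x∈ , v⊆x   = ∈-filter⁻ (⁅ i ⁆ ⊆?_) {xs = facesOfCard (2 ℕ.+ k)} x∈star
          x∈G , ∣x∣≡ = ∈-filter⁻ _ {xs = faces G} x∈
          i∈x  = v⊆x (x∈⁅x⁆ i)
          i∉tx = i∉toggle i x i∈x
          tx⊆x : toggle i x ⊆ x
          tx⊆x = toggle-⊆ i x (λ j∈x → j∈x) i∈x
          -- `i` is missing from `toggle i x`, so toggling once more adds one element and restores
          -- `x`. The resulting cardinality `suc k` is positive, which gives the non-emptiness that
          -- `closed` asks for.
          ∣tx∣≡ = ℕ.suc-injective (begin
            suc ∣ toggle i x ∣        ≡⟨ ∣toggle∣ i (toggle i x) i∉tx ⟨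
            ∣ toggle i (toggle i x) ∣ ≡⟨ cong ∣_∣ (toggle-involutive i x) ⟩
            ∣ x ∣                     ≡⟨ ∣x∣≡ ⟩
            2 ℕ.+ k                   ∎)
          tx∈G = closed G x∈G (∣p∣≡1+k⇒Nonempty (toggle i x) ∣tx∣≡) tx⊆x
          -- The face above both the vertex and `toggle i x` is `x` itself.
          tx∈S = ∈-S⁺ {v = ⁅ i ⁆} tx∈G x∈G v⊆x tx⊆x λ v⊆tx → i∉tx (v⊆tx (x∈⁅x⁆ i))
      in subst (_∈ map (toggle i) link) (toggle-involutive i x)
           (∈-map⁺ (toggle i) (∈-filter⁺ _ tx∈S ∣tx∣≡))

  -- The map `⁅_⁆` is a bijection from the elements of `x` to the vertices below `x`: closedness
  -- makes every singleton inside `x` a face, and every set of cardinality 1 is a singleton.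
  vertices-of-face : ∀ {x} → x ∈ faces G → length (filter (_⊆? x) (vertices G)) ≡ ∣ x ∣
  vertices-of-face {x} x∈G = begin
    length (filter (_⊆? x) (vertices G)) ≡⟨ length-unique
      (filter⁺ _ (filter⁺ _ (unique G)))
      (map⁺ ⁅⁆-injective (elements-unique x))
      (mk⇔ to from) ⟩
    length (map ⁅_⁆ (elements x))        ≡⟨ length-map ⁅_⁆ (elements x) ⟩
    length (elements x)                  ≡⟨ length-elements x ⟩
    ∣ x ∣                                ∎
    where
    to : ∀ {v} → v ∈ filter (_⊆? x) (vertices G) → v ∈ map ⁅_⁆ (elements x)
    to {v} v∈ with v∈V , v⊆x ← ∈-filter⁻ (_⊆? x) {xs = vertices G} v∈
      with i , refl ← ∣p∣≡1⇒singleton v (proj₂ (∈-filter⁻ _ {xs = faces G} v∈V)) =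
      ∈-map⁺ ⁅_⁆ (∈-elements⁺ (v⊆x (x∈⁅x⁆ i)))

    from : ∀ {v} → v ∈ map ⁅_⁆ (elements x) → v ∈ filter (_⊆? x) (vertices G)
    from v∈ with i , i∈ , refl ← ∈-map⁻ ⁅_⁆ v∈ =
      let v⊆x : ⁅ i ⁆ ⊆ x
          v⊆x = ⁅i⁆⊆p (∈-elements⁻ x i∈)
      in ∈-filter⁺ (_⊆? x) (∈-filter⁺ _ (closed G x∈G (i , x∈⁅x⁆ i) v⊆x) (∣⁅x⁆∣≡1 i)) v⊆x

-- The index is the cardinality, and the empty set counts: this is f_{k-1}, with f_{-1} = 1.
faceCount : SimplicialComplex n → ℕ → ℕ
faceCount H zero    = 1
faceCount H (suc k) = fCount H k

sum-faceCount-S : (G : SimplicialComplex n) (k : ℕ) →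
  sum (map (λ v → faceCount (S G v) k) (vertices G)) ≡ fCount G k ℕ.* suc k
-- Each sphere contributes 1 for the empty set, so the sum is the number of vertices, and
-- `fCount G 0` is by definition the length of `vertices G`.
sum-faceCount-S G zero    = sum-map-const (vertices G) (λ _ → refl)
sum-faceCount-S G (suc k) = begin
  sum (map (λ v → fCount (S G v) k) (vertices G))              ≡⟨ sum-map-cong (vertices G) link≡star ⟩
  sum (map (λ v → length (filter (v ⊆?_) xs)) (vertices G))    ≡⟨ double-counting _⊆?_ (vertices G) xs ⟩
  sum (map (λ x → length (filter (_⊆? x) (vertices G))) xs)    ≡⟨ sum-map-const xs vertices≡ ⟩
  fCount G (suc k) ℕ.* (2 ℕ.+ k)                               ∎
  where
  xs = facesOfCard G (2 ℕ.+ k)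

  link≡star : ∀ {v} → v ∈ vertices G → fCount (S G v) k ≡ length (filter (v ⊆?_) xs)
  link≡star {v} v∈V with i , refl ← ∣p∣≡1⇒singleton v (proj₂ (∈-filter⁻ _ {xs = faces G} v∈V)) = fCount-S G k i

  vertices≡ : ∀ {x} → x ∈ xs → length (filter (_⊆? x) (vertices G)) ≡ 2 ℕ.+ k
  vertices≡ x∈ with x∈G , ∣x∣≡ ← ∈-filter⁻ _ {xs = faces G} x∈ = trans (vertices-of-face G x∈G) ∣x∣≡

-- A face of cardinality `suc k` would exceed the maximal cardinality. Thus the truncation of
-- `fPoly` at `maxCard` loses nothing, and its coefficients have one formula in all degrees.
fCount-vanishes : (H : SimplicialComplex n) {k : ℕ} → maxCard H ≤ k → fCount H k ≡ 0
fCount-vanishes H {k} max≤k = cong length (filter-none (λ x → ∣ x ∣ ℕ.≟ suc k) (All.map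
  (λ ∣x∣≤max ∣x∣≡1+k → ℕ.<⇒≢ (s≤s (ℕ.≤-trans ∣x∣≤max max≤k)) ∣x∣≡1+k)
  (All.map⁻ (xs≤max 0 (map ∣_∣ (faces H))))))

-- Coefficients

fromℕ : ℕ → ℚ
fromℕ m = ℤ.+ m / 1

-- Since `_/_` reduces to lowest terms, the identity is checked on unnormalised fractions, where it
-- is a cross-multiplication of integers.
fromℕ-+ : (a b : ℕ) → fromℕ (a ℕ.+ b) ≡ fromℕ a + fromℕ b
fromℕ-+ a b = toℚᵘ-injective (begin≃
  toℚᵘ (fromℕ (a ℕ.+ b))                  ≈⟨ toℚᵘ-fromℚᵘ (mkℚᵘ (ℤ.+ (a ℕ.+ b)) 0) ⟩
  mkℚᵘ (ℤ.+ (a ℕ.+ b)) 0                  ≈⟨ *≡* (cong (ℤ._* ℤ.1ℤ) (sym (cong₂ ℤ._+_ (ℤ.*-identityʳ (ℤ.+ a)) (ℤ.*-identityʳ (ℤ.+ b))))) ⟩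
  mkℚᵘ (ℤ.+ a) 0 ℚᵘ.+ mkℚᵘ (ℤ.+ b) 0      ≈⟨ ℚᵘ.+-cong (toℚᵘ-fromℚᵘ (mkℚᵘ (ℤ.+ a) 0)) (toℚᵘ-fromℚᵘ (mkℚᵘ (ℤ.+ b) 0)) ⟨
  toℚᵘ (fromℕ a) ℚᵘ.+ toℚᵘ (fromℕ b)      ≈⟨ toℚᵘ-homo-+ (fromℕ a) (fromℕ b) ⟨
  toℚᵘ (fromℕ a + fromℕ b)                ∎≃)
  where open ≃-Reasoning renaming (begin_ to begin≃_; _∎ to _∎≃)

fromℕ-*-cancel : (a k : ℕ) → fromℕ (a ℕ.* suc k) * (ℤ.+ 1 / suc k) ≡ fromℕ a
fromℕ-*-cancel a k = toℚᵘ-injective (begin≃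
  toℚᵘ (fromℕ (a ℕ.* suc k) * (ℤ.+ 1 / suc k))              ≈⟨ toℚᵘ-homo-* (fromℕ (a ℕ.* suc k)) (ℤ.+ 1 / suc k) ⟩
  toℚᵘ (fromℕ (a ℕ.* suc k)) ℚᵘ.* toℚᵘ (ℤ.+ 1 / suc k)      ≈⟨ ℚᵘ.*-cong (toℚᵘ-fromℚᵘ (mkℚᵘ (ℤ.+ (a ℕ.* suc k)) 0)) (toℚᵘ-fromℚᵘ (mkℚᵘ (ℤ.+ 1) k)) ⟩
  mkℚᵘ (ℤ.+ (a ℕ.* suc k)) 0 ℚᵘ.* mkℚᵘ (ℤ.+ 1) k            ≈⟨ *≡* lemma ⟩
  mkℚᵘ (ℤ.+ a) 0                                            ≈⟨ toℚᵘ-fromℚᵘ (mkℚᵘ (ℤ.+ a) 0) ⟨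
  toℚᵘ (fromℕ a)                                            ∎≃)
  where
  open ≃-Reasoning renaming (begin_ to begin≃_; _∎ to _∎≃)
  -- The cross-multiplied equation; `suc (k + 0)` is what the product denominator `1 * suc k`
  -- computes to.
  lemma : ℤ.+ (a ℕ.* suc k) ℤ.* ℤ.1ℤ ℤ.* ℤ.1ℤ ≡ ℤ.+ a ℤ.* ℤ.+ suc (k ℕ.+ 0)
  lemma = trans (ℤ.*-identityʳ _) (trans (ℤ.*-identityʳ _)
    (trans (ℤ.pos-* a (suc k)) (cong (λ m → ℤ.+ a ℤ.* ℤ.+ suc m) (sym (ℕ.+-identityʳ k)))))

coeff-+ₚ : (p q : Poly) (i : ℕ) → coeff (p +ₚ q) i ≡ coeff p i + coeff q i
coeff-+ₚ []       q        i       = sym (+-identityˡ (coeff q i))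
coeff-+ₚ (a ∷ p)  []       i       = sym (+-identityʳ (coeff (a ∷ p) i))
coeff-+ₚ (a ∷ p)  (b ∷ q)  zero    = refl
coeff-+ₚ (a ∷ p)  (b ∷ q)  (suc i) = coeff-+ₚ p q i

coeff-divideFrom : (k : ℕ) (p : Poly) (i : ℕ) → coeff (divideFrom k p) i ≡ coeff p i * (ℤ.+ 1 / suc (k ℕ.+ i))
coeff-divideFrom k []      i       = sym (*-zeroˡ (ℤ.+ 1 / suc (k ℕ.+ i)))
coeff-divideFrom k (a ∷ p) zero    = cong (λ m → a * (ℤ.+ 1 / suc m)) (sym (ℕ.+-identityʳ k))
coeff-divideFrom k (a ∷ p) (suc i) = trans (coeff-divideFrom (suc k) p i)
  (cong (λ m → coeff p i * (ℤ.+ 1 / suc m)) (sym (ℕ.+-suc k i)))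

-- Beyond the end of the list `coeff` returns its default `0ℚ`, and `vanish` makes `f` agree with
-- that default.
coeff-applyUpTo : (f : ℕ → ℚ) (m i : ℕ) → (m ≤ i → f i ≡ 0ℚ) → coeff (applyUpTo f m) i ≡ f i
coeff-applyUpTo f zero    i       vanish = sym (vanish z≤n)
coeff-applyUpTo f (suc m) zero    vanish = refl
coeff-applyUpTo f (suc m) (suc i) vanish = coeff-applyUpTo (f ∘ suc) m i (vanish ∘ s≤s)

-- In a fixed degree all spheres share the integration factor `r`; pulling it out leaves a sum of
-- natural numbers, to which the counting identity applies.
coeff-sumₚ : {i : ℕ} {r : ℚ} (p : A → Poly) (c : A → ℕ) → (∀ x → coeff (p x) i ≡ fromℕ (c x) * r) →
  (xs : List A) → coeff (sumₚ (map p xs)) i ≡ fromℕ (sum (map c xs)) * r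
coeff-sumₚ {r = r} p c eq []       = sym (*-zeroˡ r)
coeff-sumₚ {i = i} {r} p c eq (x ∷ xs) = begin
  coeff (p x +ₚ sumₚ (map p xs)) i                    ≡⟨ coeff-+ₚ (p x) (sumₚ (map p xs)) i ⟩
  coeff (p x) i + coeff (sumₚ (map p xs)) i           ≡⟨ cong₂ _+_ (eq x) (coeff-sumₚ p c eq xs) ⟩
  fromℕ (c x) * r + fromℕ (sum (map c xs)) * r        ≡⟨ *-distribʳ-+ r (fromℕ (c x)) (fromℕ (sum (map c xs))) ⟨
  (fromℕ (c x) + fromℕ (sum (map c xs))) * r          ≡⟨ cong (_* r) (fromℕ-+ (c x) (sum (map c xs))) ⟨
  fromℕ (c x ℕ.+ sum (map c xs)) * r                  ∎

coeff-fPoly : (H : SimplicialComplex n) (k : ℕ) → coeff (fPoly H) k ≡ fromℕ (faceCount H k)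
coeff-fPoly H zero    = refl
coeff-fPoly H (suc k) = coeff-applyUpTo (fromℕ ∘ fCount H) (maxCard H) k (cong fromℕ ∘ fCount-vanishes H)

coeff-FPoly : (H : SimplicialComplex n) (k : ℕ) → coeff (FPoly H) (suc k) ≡ fromℕ (faceCount H k) * (ℤ.+ 1 / suc k)
coeff-FPoly H k = trans (coeff-divideFrom 0 (fPoly H) k) (cong (_* (ℤ.+ 1 / suc k)) (coeff-fPoly H k))

mainTheorem8 : (n : ℕ) (G : SimplicialComplex n) → fPoly G -ₚ 1ₚ ≈ₚ sumₚ (map (λ v → FPoly (S G v)) (vertices G))
-- Every `FPoly` starts with `0ℚ`, so count 0 and factor `0ℚ` describe its constant coefficient; on
-- the left `1 - 1` computes to `0ℚ`.
mainTheorem8 n G zero    = sym (trans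
  (coeff-sumₚ (λ v → FPoly (S G v)) (λ _ → 0) (λ _ → refl) (vertices G))
  (cong (λ m → fromℕ m * 0ℚ) (sum-map-zero (vertices G))))
mainTheorem8 n G (suc k) = begin
  coeff (fPoly G -ₚ 1ₚ) (suc k)                                 ≡⟨ coeff-+ₚ (fPoly G) (map -_ 1ₚ) (suc k) ⟩
  coeff (fPoly G) (suc k) + 0ℚ                                  ≡⟨ +-identityʳ _ ⟩
  coeff (fPoly G) (suc k)                                       ≡⟨ coeff-fPoly G (suc k) ⟩
  -- Multiplying and dividing by `suc k` brings in the incidence count on one side and the factor
  -- from integration on the other.
  fromℕ (fCount G k)                                            ≡⟨ fromℕ-*-cancel (fCount G k) k ⟨
  fromℕ (fCount G k ℕ.* suc k) * (ℤ.+ 1 / suc k)                ≡⟨ cong (λ m → fromℕ m * (ℤ.+ 1 / suc k)) (sum-faceCount-S G k) ⟨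
  fromℕ (sum (map (λ v → faceCount (S G v) k) (vertices G))) * (ℤ.+ 1 / suc k)
    ≡⟨ coeff-sumₚ (λ v → FPoly (S G v)) (λ v → faceCount (S G v) k) (λ v → coeff-FPoly (S G v) k) (vertices G) ⟨
  coeff (sumₚ (map (λ v → FPoly (S G v)) (vertices G))) (suc k) ∎
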